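{- Let $t,s\in\mathcal T_\lambda$. (1) If $t\to_{\mathtt n}s$, then $t^{\mathsf{cbn}}\to_{\mathtt w}s^{\mathsf{cbn}}$. (2) If $t\to_{\mathtt v}s$, then $t^{\mathsf{cbv}}\to_{\mathtt w}^{+}s^{\mathsf{cbv}}$ (transitive closure). Moreover, in (1) and (2), exponential source steps ($\mathtt s$-steps of $\to_{\mathtt n}$, $\mathtt{sv}$-steps of $\to_{\mathtt v}$) are always simulated by exponential steps of $\to_{\mathtt w}$ (that is, there is such a simulating reduction consisting only of $\mathtt{s!}$- and $\mathtt{d!}$-steps), while multiplicative source steps ($\mathtt{dB}$-steps) are simulated by at least one multiplicative step (that is, there is such a simulating reduction containing at least one $\mathtt{dB}$-step).
   Context: Source terms $\mathcal T_\lambda$: $t,u ::= v\mid t\,u\mid t[x\backslash u]$, with values $v ::= x\mid\lambda x.t$. Target terms ($\lambda!$-calculus): $t,u ::= x \mid t\,u \mid \lambda x.t \mid {!t} \mid \mathrm{der}\,t \mid t[x\backslash u]$. Here $[x\backslash u]$ is a syntactic explicit substitution; $\lambda x.t$ and $t[x\backslash u]$ bind $x$ in $t$; terms are modulo $\alpha$-conversion; $t\{x\backslash u\}$ is capture-avoiding meta-level substitution. List contexts (in both languages): $L ::= \Box\mid L[x\backslash t]$; $C\langle t\rangle$ plugs $t$ in the hole of $C$. Source reductions (rules avoid capture): $\mathtt{dB}$: $L\langle\lambda x.t\rangle\,u\mapsto L\langle t[x\backslash u]\rangle$; $\mathtt{s}$: $t[x\backslash u]\mapsto t\{x\backslash u\}$;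 $\mathtt{sv}$: $t[x\backslash L\langle v\rangle]\mapsto L\langle t\{x\backslash v\}\rangle$ ($v$ a value). $\to_{\mathtt n}$ is the closure of $\mathtt{dB}$ and $\mathtt s$ under contexts $N ::= \Box\mid N\,t\mid\lambda x.N\mid N[x\backslash u]$. $\to_{\mathtt v}$ is the closure of $\mathtt{dB}$ and $\mathtt{sv}$ under contexts $V ::= \Box\mid V\,t\mid t\,V\mid V[x\backslash u]\mid t[x\backslash V]$. Target reduction: $\to_{\mathtt w}$ is the closure, under weak contexts $W ::= \Box \mid W\,t \mid t\,W \mid \lambda x.W \mid \mathrm{der}\,W \mid W[x\backslash u] \mid t[x\backslash W]$, of the rules (avoiding capture) $\mathtt{dB}$: $L\langle\lambda x.t\rangle\,u \mapsto L\langle t[x\backslash u]\rangle$; $\mathtt{s!}$: $t[x\backslash L\langle !u\rangle] \mapsto L\langle t\{x\backslash u\}\rangle$; $\mathtt{d!}$: $\mathrm{der}(L\langle !t\rangle)\mapsto L\langle t\rangle$. $\mathtt{dB}$-steps are multiplicative, $\mathtt{s!}$- and $\mathtt{d!}$-steps exponential. Embeddings: $x^{\mathsf{cbn}}=x$, $(\lambda x.t)^{\mathsf{cbn}}=\lambda x.t^{\mathsf{cbn}}$, $(t\,u)^{\mathsf{cbn}}=t^{\mathsf{cbn}}\,{!u^{\mathsf{cbn}}}$, $(t[x\backslash u])^{\mathsf{cbn}}=t^{\mathsf{cbn}}[x\backslash{!u^{\mathsf{cbn}}}]$; $x^{\mathsf{cbv}}={!x}$, $(\lambda x.t)^{\mathsf{cbv}}={!(\lambda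 x.t^{\mathsf{cbv}})}$, $(t\,u)^{\mathsf{cbv}}=L\langle s\rangle\,u^{\mathsf{cbv}}$ if $t^{\mathsf{cbv}}=L\langle{!s}\rangle$ for some list context $L$ and term $s$, and $(t\,u)^{\mathsf{cbv}}=\mathrm{der}(t^{\mathsf{cbv}})\,u^{\mathsf{cbv}}$ otherwise; $(t[x\backslash u])^{\mathsf{cbv}}=t^{\mathsf{cbv}}[x\backslash u^{\mathsf{cbv}}]$. -}

module Defs where

open import Data.Nat using (ℕ; suc)
open import Data.Fin using (Fin; zero; suc)
open import Data.Product using (Σ-syntax; ∃-syntax; _×_; _,_)
open import Function using (id; _∘_)
open import Relation.Nullary using (Dec; yes; no)
open import Relation.Binary.PropositionalEquality using (_≡_; refl)
open import Relation.Binary.Construct.Closure.Transitive using (TransClosure)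
open import Relation.Binary.Construct.Closure.ReflexiveTransitive using (Star)

-- Terms modulo α are well-scoped de Bruijn terms: `Term n` has its free
-- variables in `Fin n`, and binders bind index `zero`.  A context `C m n`
-- turns a term of scope n (in the hole) into a term of scope m; plugging is
-- capturing, so n exceeds m by the number of binders above the hole.

data Kind : Set where
  mul exp : Kind

lift : ∀ {m n} → (Fin m → Fin n) → Fin (suc m) → Fin (suc n)
lift ρ zero    = zero
lift ρ (suc x) = suc (ρ x)

module Source where

  infixl 7 _·_
  infixl 8 _[\_] _⟪\_⟫

  data Term (n : ℕ) : Set where
    var   : Fin n → Term n
    ƛ     : Term (suc n) → Term n
    _·_   : Term n → Term n → Term n
    _[\_] : Term (suc n) → Term n → Term n

  data Value {n : ℕ} : Term n → Set where
    var : ∀ x → Value (var x)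
    ƛ   : ∀ t → Value (ƛ t)

  rename : ∀ {m n} → (Fin m → Fin n) → Term m → Term n
  rename ρ (var x)    = var (ρ x)
  rename ρ (ƛ t)      = ƛ (rename (lift ρ) t)
  rename ρ (t · u)    = rename ρ t · rename ρ u
  rename ρ (t [\ u ]) = rename (lift ρ) t [\ rename ρ u ]

  lifts : ∀ {m n} → (Fin m → Term n) → Fin (suc m) → Term (suc n)
  lifts σ zero    = var zero
  lifts σ (suc x) = rename suc (σ x)

  subst : ∀ {m n} → (Fin m → Term n) → Term m → Term n
  subst σ (var x)    = σ x
  subst σ (ƛ t)      = ƛ (subst (lifts σ) t)
  subst σ (t · u)    = subst σ t · subst σ u
  subst σ (t [\ u ]) = subst (lifts σ) t [\ subst σ u ]

  single : ∀ {n} → Term n → Fin (suc n) → Term n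
  single u zero    = u
  single u (suc x) = var x

  -- Meta-level substitution of u for index zero, as opposed to the
  -- constructor _[\_].
  _⟪\_⟫ : ∀ {n} → Term (suc n) → Term n → Term n
  t ⟪\ u ⟫ = subst (single u) t

  data LCtx : ℕ → ℕ → Set where
    □     : ∀ {n} → LCtx n n
    _[\_] : ∀ {m n} → LCtx (suc m) n → Term m → LCtx m n

  plugL : ∀ {m n} → LCtx m n → Term n → Term m
  plugL □          t = t
  plugL (L [\ u ]) t = plugL L t [\ u ]

  -- Moves a variable below the binders of L; renaming with it is what keeps
  -- the rules at a distance from capturing.
  under : ∀ {m n} → LCtx m n → Fin m → Fin n
  under □          = id
  under (L [\ _ ]) = under L ∘ suc

  data _↦dB_ {m : ℕ} : Term m → Term m → Set where
    dB : ∀ {n} (L : LCtx m n) (t : Term (suc n)) (u : Term m) →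
         (plugL L (ƛ t) · u) ↦dB plugL L (t [\ rename (under L) u ])

  data _↦s_ {m : ℕ} : Term m → Term m → Set where
    s : (t : Term (suc m)) (u : Term m) → (t [\ u ]) ↦s (t ⟪\ u ⟫)

  data _↦sv_ {m : ℕ} : Term m → Term m → Set where
    sv : ∀ {n} (t : Term (suc m)) (L : LCtx m n) {v : Term n} → Value v →
         (t [\ plugL L v ]) ↦sv plugL L (rename (lift (under L)) t ⟪\ v ⟫)

  data NCtx : ℕ → ℕ → Set where
    □     : ∀ {n} → NCtx n n
    _·_   : ∀ {m n} → NCtx m n → Term m → NCtx m n
    ƛ     : ∀ {m n} → NCtx (suc m) n → NCtx m n
    _[\_] : ∀ {m n} → NCtx (suc m) n → Term m → NCtx m n

  plugN : ∀ {m n} → NCtx m n → Term n → Term m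
  plugN □          t = t
  plugN (N · u)    t = plugN N t · u
  plugN (ƛ N)      t = ƛ (plugN N t)
  plugN (N [\ u ]) t = plugN N t [\ u ]

  data VCtx : ℕ → ℕ → Set where
    □     : ∀ {n} → VCtx n n
    _·ˡ_  : ∀ {m n} → VCtx m n → Term m → VCtx m n
    _·ʳ_  : ∀ {m n} → Term m → VCtx m n → VCtx m n
    _[\_]ˡ : ∀ {m n} → VCtx (suc m) n → Term m → VCtx m n
    _[\_]ʳ : ∀ {m n} → Term (suc m) → VCtx m n → VCtx m n

  plugV : ∀ {m n} → VCtx m n → Term n → Term m
  plugV □           t = t
  plugV (V ·ˡ u)    t = plugV V t · u
  plugV (u ·ʳ V)    t = u · plugV V t
  plugV (V [\ u ]ˡ) t = plugV V t [\ u ]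
  plugV (u [\ V ]ʳ) t = u [\ plugV V t ]

  data _↦n⟨_⟩_ {n : ℕ} : Term n → Kind → Term n → Set where
    dB : ∀ {t u} → t ↦dB u → t ↦n⟨ mul ⟩ u
    s  : ∀ {t u} → t ↦s u → t ↦n⟨ exp ⟩ u

  data _↦v⟨_⟩_ {n : ℕ} : Term n → Kind → Term n → Set where
    dB : ∀ {t u} → t ↦dB u → t ↦v⟨ mul ⟩ u
    sv : ∀ {t u} → t ↦sv u → t ↦v⟨ exp ⟩ u

  data _→n⟨_⟩_ {m : ℕ} : Term m → Kind → Term m → Set where
    step : ∀ {n} (N : NCtx m n) {t u k} → t ↦n⟨ k ⟩ u →
           plugN N t →n⟨ k ⟩ plugN N u

  data _→v⟨_⟩_ {m : ℕ} : Term m → Kind → Term m → Set where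
    step : ∀ {n} (V : VCtx m n) {t u k} → t ↦v⟨ k ⟩ u →
           plugV V t →v⟨ k ⟩ plugV V u

  _→n_ _→v_ : ∀ {n} → Term n → Term n → Set
  t →n u = ∃[ k ] t →n⟨ k ⟩ u
  t →v u = ∃[ k ] t →v⟨ k ⟩ u

module Target where

  infixl 7 _·_
  infixl 8 _[\_] _⟪\_⟫

  data Term (n : ℕ) : Set where
    var   : Fin n → Term n
    ƛ     : Term (suc n) → Term n
    _·_   : Term n → Term n → Term n
    !     : Term n → Term n
    der   : Term n → Term n
    _[\_] : Term (suc n) → Term n → Term n

  rename : ∀ {m n} → (Fin m → Fin n) → Term m → Term n
  rename ρ (var x)    = var (ρ x)
  rename ρ (ƛ t)      = ƛ (rename (lift ρ) t)
  rename ρ (t · u)    = rename ρ t · rename ρ u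
  rename ρ (! t)      = ! (rename ρ t)
  rename ρ (der t)    = der (rename ρ t)
  rename ρ (t [\ u ]) = rename (lift ρ) t [\ rename ρ u ]

  lifts : ∀ {m n} → (Fin m → Term n) → Fin (suc m) → Term (suc n)
  lifts σ zero    = var zero
  lifts σ (suc x) = rename suc (σ x)

  subst : ∀ {m n} → (Fin m → Term n) → Term m → Term n
  subst σ (var x)    = σ x
  subst σ (ƛ t)      = ƛ (subst (lifts σ) t)
  subst σ (t · u)    = subst σ t · subst σ u
  subst σ (! t)      = ! (subst σ t)
  subst σ (der t)    = der (subst σ t)
  subst σ (t [\ u ]) = subst (lifts σ) t [\ subst σ u ]

  single : ∀ {n} → Term n → Fin (suc n) → Term n
  single u zero    = u
  single u (suc x) = var x

  _⟪\_⟫ : ∀ {n} → Term (suc n) → Term n → Term n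
  t ⟪\ u ⟫ = subst (single u) t

  data LCtx : ℕ → ℕ → Set where
    □     : ∀ {n} → LCtx n n
    _[\_] : ∀ {m n} → LCtx (suc m) n → Term m → LCtx m n

  plugL : ∀ {m n} → LCtx m n → Term n → Term m
  plugL □          t = t
  plugL (L [\ u ]) t = plugL L t [\ u ]

  under : ∀ {m n} → LCtx m n → Fin m → Fin n
  under □          = id
  under (L [\ _ ]) = under L ∘ suc

  data _↦⟨_⟩_ {m : ℕ} : Term m → Kind → Term m → Set where
    dB : ∀ {n} (L : LCtx m n) (t : Term (suc n)) (u : Term m) →
         (plugL L (ƛ t) · u) ↦⟨ mul ⟩ plugL L (t [\ rename (under L) u ])
    s! : ∀ {n} (t : Term (suc m)) (L : LCtx m n) (u : Term n) →
         (t [\ plugL L (! u) ]) ↦⟨ exp ⟩ plugL L (rename (lift (under L)) t ⟪\ u ⟫)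
    d! : ∀ {n} (L : LCtx m n) (t : Term n) →
         der (plugL L (! t)) ↦⟨ exp ⟩ plugL L t

  -- Weak contexts: no hole under !.
  data WCtx : ℕ → ℕ → Set where
    □      : ∀ {n} → WCtx n n
    _·ˡ_   : ∀ {m n} → WCtx m n → Term m → WCtx m n
    _·ʳ_   : ∀ {m n} → Term m → WCtx m n → WCtx m n
    ƛ      : ∀ {m n} → WCtx (suc m) n → WCtx m n
    der    : ∀ {m n} → WCtx m n → WCtx m n
    _[\_]ˡ : ∀ {m n} → WCtx (suc m) n → Term m → WCtx m n
    _[\_]ʳ : ∀ {m n} → Term (suc m) → WCtx m n → WCtx m n

  plugW : ∀ {m n} → WCtx m n → Term n → Term m
  plugW □           t = t
  plugW (W ·ˡ u)    t = plugW W t · u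
  plugW (u ·ʳ W)    t = u · plugW W t
  plugW (ƛ W)       t = ƛ (plugW W t)
  plugW (der W)     t = der (plugW W t)
  plugW (W [\ u ]ˡ) t = plugW W t [\ u ]
  plugW (u [\ W ]ʳ) t = u [\ plugW W t ]

  data _→w⟨_⟩_ {m : ℕ} : Term m → Kind → Term m → Set where
    step : ∀ {n} (W : WCtx m n) {t u k} → t ↦⟨ k ⟩ u →
           plugW W t →w⟨ k ⟩ plugW W u

  _→w_ _→w⁺_ _→w*_ _→w⟨exp⟩⁺_ _→w*∋mul_ : ∀ {n} → Term n → Term n → Set
  t →w u = ∃[ k ] t →w⟨ k ⟩ u
  _→w⁺_ = TransClosure _→w_
  _→w*_ = Star _→w_
  _→w⟨exp⟩⁺_ = TransClosure (_→w⟨ exp ⟩_)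

  -- Reductions containing at least one multiplicative step.
  t →w*∋mul u = ∃[ p ] ∃[ q ] (t →w* p) × (p →w⟨ mul ⟩ q) × (q →w* u)

  Banged : ∀ {m} → Term m → Set
  Banged {m} t = ∃[ n ] Σ[ L ∈ LCtx m n ] Σ[ s ∈ Term n ] t ≡ plugL L (! s)

  banged? : ∀ {m} (t : Term m) → Dec (Banged t)
  banged? (var x) = no λ { (_ , □ , _ , ()) ; (_ , _ [\ _ ] , _ , ()) }
  banged? (ƛ t)   = no λ { (_ , □ , _ , ()) ; (_ , _ [\ _ ] , _ , ()) }
  banged? (t · u) = no λ { (_ , □ , _ , ()) ; (_ , _ [\ _ ] , _ , ()) }
  banged? (! t)   = yes (_ , □ , t , refl)
  banged? (der t) = no λ { (_ , □ , _ , ()) ; (_ , _ [\ _ ] , _ , ()) }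
  banged? (t [\ u ]) with banged? t
  ... | yes (n , L , s , refl) = yes (n , L [\ u ] , s , refl)
  ... | no ¬b = no λ { (n , L [\ _ ] , s , refl) → ¬b (n , L , s , refl) }

  -- The decomposition of t as L⟨!s⟩ is unique when it exists, so the choice
  -- made by banged? is immaterial.
  cbvApp : ∀ {m} → Term m → Term m → Term m
  cbvApp t u with banged? t
  ... | yes (_ , L , s , _) = plugL L s · u
  ... | no _                = der t · u

open Source using (_→n_; _→v_; _→n⟨_⟩_; _→v⟨_⟩_) public
open Target using (_→w_; _→w⁺_; _→w⟨_⟩_; _→w⟨exp⟩⁺_; _→w*∋mul_) public

cbn : ∀ {n} → Source.Term n → Target.Term n
cbn (Source.var x)      = Target.var x
cbn (Source.ƛ t)        = Target.ƛ (cbn t)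
cbn (t Source.· u)      = cbn t Target.· Target.! (cbn u)
cbn (t Source.[\ u ])   = cbn t Target.[\ Target.! (cbn u) ]

cbv : ∀ {n} → Source.Term n → Target.Term n
cbv (Source.var x)      = Target.! (Target.var x)
cbv (Source.ƛ t)        = Target.! (Target.ƛ (cbv t))
cbv (t Source.· u)      = Target.cbvApp (cbv t) (cbv u)
cbv (t Source.[\ u ])   = cbv t Target.[\ cbv u ]

{-# OPTIONS --safe #-}
-- Both embeddings commute with renaming, with substitution (of values, for
-- cbv) and with list contexts, so a root step is matched by a single root step
-- of the same kind, and it remains to close under contexts.  For cbn this is
-- immediate.  For cbv the delicate context is V u: the translation of the
-- function part is either L⟨!s⟩, in which case every step from it is also
-- available, in the same kind, from L⟨s⟩; or it has an application below its
-- list context and is guarded by der, in which case one further d!-step is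
-- needed if its reduct is of the form L⟨!s⟩.
module Submission where

open import Data.Nat using (ℕ; suc)
open import Data.Fin using (Fin; zero; suc)
open import Data.Product using (∃-syntax; _×_; _,_; map₂)
open import Data.Sum using (_⊎_; inj₁; inj₂)
open import Data.Empty using (⊥-elim)
open import Function using (id; _∘_)
open import Relation.Nullary using (¬_; yes; no)
open import Relation.Binary.PropositionalEquality
  using (_≡_; refl; sym; trans; cong; cong₂; subst₂; module ≡-Reasoning)
open import Relation.Binary.Construct.Closure.Transitive
  using (TransClosure; [_]; _∷_)
open import Relation.Binary.Construct.Closure.ReflexiveTransitive
  using (Star; ε; _◅_; _◅◅_; gmap)
import Relation.Binary.Construct.Closure.ReflexiveTransitive as Star
open import Defs

open Target
module S = Source

private variable
  m n : ℕ
  k : Kind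

-- Compatibility of weak reduction with every constructor except the bang.

step-·ˡ : {t t′ u : Term n} → t →w⟨ k ⟩ t′ → (t · u) →w⟨ k ⟩ (t′ · u)
step-·ˡ (step W r) = step (W ·ˡ _) r

step-·ʳ : {t u u′ : Term n} → u →w⟨ k ⟩ u′ → (t · u) →w⟨ k ⟩ (t · u′)
step-·ʳ (step W r) = step (_ ·ʳ W) r

step-ƛ : {t t′ : Term (suc n)} → t →w⟨ k ⟩ t′ → ƛ t →w⟨ k ⟩ ƛ t′
step-ƛ (step W r) = step (ƛ W) r

step-der : {t t′ : Term n} → t →w⟨ k ⟩ t′ → der t →w⟨ k ⟩ der t′
step-der (step W r) = step (der W) r

step-[\]ˡ : {t t′ : Term (suc n)} {u : Term n} →
  t →w⟨ k ⟩ t′ → (t [\ u ]) →w⟨ k ⟩ (t′ [\ u ])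
step-[\]ˡ (step W r) = step (W [\ _ ]ˡ) r

step-[\]ʳ : {t : Term (suc n)} {u u′ : Term n} →
  u →w⟨ k ⟩ u′ → (t [\ u ]) →w⟨ k ⟩ (t [\ u′ ])
step-[\]ʳ (step W r) = step (_ [\ W ]ʳ) r

-- Call-by-name

-- Firing `s!` with the empty list context leaves `rename (lift id)` on the body, which is the
-- identity only propositionally.
rename-id : {ρ : Fin n → Fin n} → (∀ x → ρ x ≡ x) →
  (t : Term n) → rename ρ t ≡ t

lift-id : {ρ : Fin n → Fin n} → (∀ x → ρ x ≡ x) → ∀ x → lift ρ x ≡ x
lift-id h zero    = refl
lift-id h (suc x) = cong suc (h x)

rename-id h (var x)    = cong var (h x)
rename-id h (ƛ t)      = cong ƛ (rename-id (lift-id h) t)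
rename-id h (t · u)    = cong₂ _·_ (rename-id h t) (rename-id h u)
rename-id h (! t)      = cong ! (rename-id h t)
rename-id h (der t)    = cong der (rename-id h t)
rename-id h (t [\ u ]) = cong₂ _[\_] (rename-id (lift-id h) t) (rename-id h u)

cbn-rename : (ρ : Fin m → Fin n) (t : S.Term m) →
  cbn (S.rename ρ t) ≡ rename ρ (cbn t)
cbn-rename ρ (S.var x)    = refl
cbn-rename ρ (S.ƛ t)      = cong ƛ (cbn-rename (lift ρ) t)
cbn-rename ρ (t S.· u)    =
  cong₂ (λ a b → a · ! b) (cbn-rename ρ t) (cbn-rename ρ u)
cbn-rename ρ (t S.[\ u ]) =
  cong₂ (λ a b → a [\ ! b ]) (cbn-rename (lift ρ) t) (cbn-rename ρ u)

cbn-lifts : {σ : Fin m → S.Term n} {τ : Fin m → Term n} →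
  (∀ x → cbn (σ x) ≡ τ x) → ∀ x → cbn (S.lifts σ x) ≡ lifts τ x
cbn-lifts h zero = refl
cbn-lifts {σ = σ} h (suc x) =
  trans (cbn-rename suc (σ x)) (cong (rename suc) (h x))

-- Relating `σ` and `τ` pointwise lets the induction pass under binders without function
-- extensionality.
cbn-subst : {σ : Fin m → S.Term n} {τ : Fin m → Term n} →
  (∀ x → cbn (σ x) ≡ τ x) →
  (t : S.Term m) → cbn (S.subst σ t) ≡ subst τ (cbn t)
cbn-subst h (S.var x)    = h x
cbn-subst h (S.ƛ t)      = cong ƛ (cbn-subst (cbn-lifts h) t)
cbn-subst h (t S.· u)    =
  cong₂ (λ a b → a · ! b) (cbn-subst h t) (cbn-subst h u)
cbn-subst h (t S.[\ u ]) =
  cong₂ (λ a b → a [\ ! b ]) (cbn-subst (cbn-lifts h) t) (cbn-subst h u)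

cbn-⟪\⟫ : (t : S.Term (suc n)) (u : S.Term n) →
  cbn (t S.⟪\ u ⟫) ≡ cbn t ⟪\ cbn u ⟫
cbn-⟪\⟫ t u = cbn-subst (λ { zero → refl ; (suc x) → refl }) t

cbnL : S.LCtx m n → LCtx m n
cbnL S.□          = □
cbnL (L S.[\ u ]) = cbnL L [\ ! (cbn u) ]

cbn-plugL : (L : S.LCtx m n) (t : S.Term n) →
  cbn (S.plugL L t) ≡ plugL (cbnL L) (cbn t)
cbn-plugL S.□          t = refl
cbn-plugL (L S.[\ u ]) t = cong (_[\ ! (cbn u) ]) (cbn-plugL L t)

-- Both sides compose one `suc` per explicit substitution, so they are equal as functions and can be
-- rewritten inside `rename`.
under-cbnL : (L : S.LCtx m n) → S.under L ≡ under (cbnL L)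
under-cbnL S.□          = refl
under-cbnL (L S.[\ u ]) = cong (_∘ suc) (under-cbnL L)

cbn-root : {t u : S.Term n} → t S.↦n⟨ k ⟩ u → cbn t ↦⟨ k ⟩ cbn u
cbn-root (S.dB (S.dB L t u)) =
  subst₂ _↦⟨ mul ⟩_ (sym lhs) (sym rhs) (dB (cbnL L) (cbn t) (! (cbn u)))
  where
  lhs : cbn (S.plugL L (S.ƛ t) S.· u) ≡ plugL (cbnL L) (ƛ (cbn t)) · ! (cbn u)
  lhs = cong (_· ! (cbn u)) (cbn-plugL L (S.ƛ t))

  rhs : cbn (S.plugL L (t S.[\ S.rename (S.under L) u ])) ≡
        plugL (cbnL L) (cbn t [\ rename (under (cbnL L)) (! (cbn u)) ])
  rhs = trans (cbn-plugL L _)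
    (cong (λ a → plugL (cbnL L) (cbn t [\ ! a ]))
      (trans (cbn-rename (S.under L) u)
        (cong (λ ρ → rename ρ (cbn u)) (under-cbnL L))))
cbn-root (S.s (S.s t u)) =
  subst₂ _↦⟨ exp ⟩_ refl rhs (s! (cbn t) □ (cbn u))
  where
  rhs : rename (lift id) (cbn t) ⟪\ cbn u ⟫ ≡ cbn (t S.⟪\ u ⟫)
  rhs = trans (cong _⟪\ cbn u ⟫ (rename-id (lift-id λ _ → refl) (cbn t)))
    (sym (cbn-⟪\⟫ t u))

-- The embedding puts bangs around arguments only, where these contexts have no hole, so each of
-- them becomes a weak context.
cbn-sim : (N : S.NCtx m n) {t u : S.Term n} → t S.↦n⟨ k ⟩ u →
  cbn (S.plugN N t) →w⟨ k ⟩ cbn (S.plugN N u)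
cbn-sim S.□ r = step □ (cbn-root r)
cbn-sim (N S.· u) r = step-·ˡ (cbn-sim N r)
cbn-sim (S.ƛ N) r = step-ƛ (cbn-sim N r)
cbn-sim (N S.[\ u ]) r = step-[\]ˡ (cbn-sim N r)

-- Function parts of translated applications

-- Unbang t w: t = L⟨!s⟩ and w = L⟨s⟩ for some L and s.
data Unbang : Term n → Term n → Set where
  bang : {s : Term n} → Unbang (! s) s
  sub  : {t w : Term (suc n)} {u : Term n} →
         Unbang t w → Unbang (t [\ u ]) (w [\ u ])

-- t = L⟨r u⟩ for some L, r and u.
data ApplicationHeaded : Term n → Set where
  app : {t u : Term n} → ApplicationHeaded (t · u)
  sub : {t : Term (suc n)} {u : Term n} →
        ApplicationHeaded t → ApplicationHeaded (t [\ u ])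

-- The second alternative is a positive reason for having no bang. Mere absence of a bang is not
-- stable under substitution, which may replace a variable by a bang; an application at the head
-- stays there.
Shape : Term n → Set
Shape t = (∃[ w ] Unbang t w) ⊎ ApplicationHeaded t

plugL-unbang : (L : LCtx m n) {t w : Term n} →
  Unbang t w → Unbang (plugL L t) (plugL L w)
plugL-unbang □          b = b
plugL-unbang (L [\ u ]) b = sub (plugL-unbang L b)

unbang-decompose : {t w : Term m} → Unbang t w →
  ∃[ n ] ∃[ L ] ∃[ s ] t ≡ plugL {m} {n} L (! s) × w ≡ plugL L s
unbang-decompose bang = _ , □ , _ , refl , refl
unbang-decompose (sub {u = u} b) with unbang-decompose b
... | _ , L , s , refl , refl = _ , L [\ u ] , s , refl , refl

-- Lets the decomposition found by `banged?` be exchanged for any given one.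
unbang-unique : {t v w : Term n} → Unbang t v → Unbang t w → v ≡ w
unbang-unique bang    bang    = refl
unbang-unique (sub b) (sub c) = cong (_[\ _ ]) (unbang-unique b c)

applicationHeaded⇒¬banged : {t : Term n} → ApplicationHeaded t → ¬ Banged t
applicationHeaded⇒¬banged app     (_ , □ , _ , ())
applicationHeaded⇒¬banged app     (_ , _ [\ _ ] , _ , ())
applicationHeaded⇒¬banged (sub a) (_ , L [\ _ ] , s , refl) =
  applicationHeaded⇒¬banged a (_ , L , s , refl)

unbang-rename : (ρ : Fin m → Fin n) {t w : Term m} →
  Unbang t w → Unbang (rename ρ t) (rename ρ w)
unbang-rename ρ bang    = bang
unbang-rename ρ (sub b) = sub (unbang-rename (lift ρ) b)

unbang-subst : (σ : Fin m → Term n) {t w : Term m} →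
  Unbang t w → Unbang (subst σ t) (subst σ w)
unbang-subst σ bang    = bang
unbang-subst σ (sub b) = sub (unbang-subst (lifts σ) b)

applicationHeaded-rename : (ρ : Fin m → Fin n) {t : Term m} →
  ApplicationHeaded t → ApplicationHeaded (rename ρ t)
applicationHeaded-rename ρ app     = app
applicationHeaded-rename ρ (sub a) = sub (applicationHeaded-rename (lift ρ) a)

applicationHeaded-subst : (σ : Fin m → Term n) {t : Term m} →
  ApplicationHeaded t → ApplicationHeaded (subst σ t)
applicationHeaded-subst σ app     = app
applicationHeaded-subst σ (sub a) = sub (applicationHeaded-subst (lifts σ) a)

cbvApp-unbang : {t w : Term n} (u : Term n) → Unbang t w → cbvApp t u ≡ w · u
cbvApp-unbang {t = t} u b with banged? t
... | yes (_ , L , _ , refl) =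
      cong (_· u) (unbang-unique (plugL-unbang L bang) b)
... | no ¬b with unbang-decompose b
...   | _ , L , s , eq , _ = ⊥-elim (¬b (_ , L , s , eq))

cbvApp-der : {t : Term n} (u : Term n) →
  ApplicationHeaded t → cbvApp t u ≡ der t · u
cbvApp-der {t = t} u a with banged? t
... | yes b = ⊥-elim (applicationHeaded⇒¬banged a b)
... | no  _ = refl

cbvApp-applicationHeaded : (t u : Term n) → ApplicationHeaded (cbvApp t u)
cbvApp-applicationHeaded t u with banged? t
... | yes (_ , _ , _ , _) = app
... | no _                = app

-- Renaming preserves each shape, so `cbvApp` takes the same branch before and after.
cbvApp-rename : (ρ : Fin m → Fin n) {t : Term m} (u : Term m) → Shape t →
  cbvApp (rename ρ t) (rename ρ u) ≡ rename ρ (cbvApp t u)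
cbvApp-rename ρ u (inj₁ (_ , b)) =
  trans (cbvApp-unbang (rename ρ u) (unbang-rename ρ b))
        (cong (rename ρ) (sym (cbvApp-unbang u b)))
cbvApp-rename ρ u (inj₂ a) =
  trans (cbvApp-der (rename ρ u) (applicationHeaded-rename ρ a))
        (cong (rename ρ) (sym (cbvApp-der u a)))

cbvApp-subst : (σ : Fin m → Term n) {t : Term m} (u : Term m) → Shape t →
  cbvApp (subst σ t) (subst σ u) ≡ subst σ (cbvApp t u)
cbvApp-subst σ u (inj₁ (_ , b)) =
  trans (cbvApp-unbang (subst σ u) (unbang-subst σ b))
        (cong (subst σ) (sym (cbvApp-unbang u b)))
cbvApp-subst σ u (inj₂ a) =
  trans (cbvApp-der (subst σ u) (applicationHeaded-subst σ a))
        (cong (subst σ) (sym (cbvApp-der u a)))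

-- Call-by-value

-- Values translate to bangs, both branches of `cbvApp` produce an application, and explicit
-- substitutions only extend the list context.
cbv-shape : (t : S.Term n) → Shape (cbv t)
cbv-shape (S.var x) = inj₁ (_ , bang)
cbv-shape (S.ƛ t)   = inj₁ (_ , bang)
cbv-shape (t S.· u) = inj₂ (cbvApp-applicationHeaded (cbv t) (cbv u))
cbv-shape (t S.[\ u ]) with cbv-shape t
... | inj₁ (_ , b) = inj₁ (_ , sub b)
... | inj₂ a       = inj₂ (sub a)

cbv-rename : (ρ : Fin m → Fin n) (t : S.Term m) →
  cbv (S.rename ρ t) ≡ rename ρ (cbv t)
cbv-rename ρ (S.var x)    = refl
cbv-rename ρ (S.ƛ t)      = cong (! ∘ ƛ) (cbv-rename (lift ρ) t)
cbv-rename ρ (t S.· u)    =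
  trans (cong₂ cbvApp (cbv-rename ρ t) (cbv-rename ρ u))
        (cbvApp-rename ρ (cbv u) (cbv-shape t))
cbv-rename ρ (t S.[\ u ]) =
  cong₂ _[\_] (cbv-rename (lift ρ) t) (cbv-rename ρ u)

cbv-lifts : {σ : Fin m → S.Term n} {τ : Fin m → Term n} →
  (∀ x → cbv (σ x) ≡ ! (τ x)) → ∀ x → cbv (S.lifts σ x) ≡ ! (lifts τ x)
cbv-lifts h zero = refl
cbv-lifts {σ = σ} h (suc x) =
  trans (cbv-rename suc (σ x)) (cong (rename suc) (h x))

-- A source variable becomes a banged variable, so the target substitution supplies what lies below
-- the bang: replacing `x` by `τ x` in `! (var x)` yields the translated value.
cbv-subst : {σ : Fin m → S.Term n} {τ : Fin m → Term n} →
  (∀ x → cbv (σ x) ≡ ! (τ x)) →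
  (t : S.Term m) → cbv (S.subst σ t) ≡ subst τ (cbv t)
cbv-subst h (S.var x)    = h x
cbv-subst h (S.ƛ t)      = cong (! ∘ ƛ) (cbv-subst (cbv-lifts h) t)
cbv-subst {τ = τ} h (t S.· u) =
  trans (cong₂ cbvApp (cbv-subst h t) (cbv-subst h u))
        (cbvApp-subst τ (cbv u) (cbv-shape t))
cbv-subst h (t S.[\ u ]) =
  cong₂ _[\_] (cbv-subst (cbv-lifts h) t) (cbv-subst h u)

cbv-⟪\⟫ : (t : S.Term (suc n)) {v : S.Term n} {w : Term n} →
  cbv v ≡ ! w → cbv (t S.⟪\ v ⟫) ≡ cbv t ⟪\ w ⟫
cbv-⟪\⟫ t eq = cbv-subst (λ { zero → eq ; (suc x) → refl }) t

cbvL : S.LCtx m n → LCtx m n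
cbvL S.□          = □
cbvL (L S.[\ u ]) = cbvL L [\ cbv u ]

cbv-plugL : (L : S.LCtx m n) (t : S.Term n) →
  cbv (S.plugL L t) ≡ plugL (cbvL L) (cbv t)
cbv-plugL S.□          t = refl
cbv-plugL (L S.[\ u ]) t = cong (_[\ cbv u ]) (cbv-plugL L t)

under-cbvL : (L : S.LCtx m n) → S.under L ≡ under (cbvL L)
under-cbvL S.□          = refl
under-cbvL (L S.[\ u ]) = cong (_∘ suc) (under-cbvL L)

cbv-value : {v : S.Term n} → S.Value v → ∃[ w ] cbv v ≡ ! w
cbv-value (S.var x) = _ , refl
cbv-value (S.ƛ t)   = _ , refl

cbv-root : {t u : S.Term n} → t S.↦v⟨ k ⟩ u → cbv t ↦⟨ k ⟩ cbv u
cbv-root (S.dB (S.dB L t u)) =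
  subst₂ _↦⟨ mul ⟩_ (sym lhs) (sym rhs) (dB (cbvL L) (cbv t) (cbv u))
  where
  -- The abstraction is translated with a bang, which `cbvApp` strips; this exposes a `dB`-redex
  -- with no `der` in the way.
  lhs : cbv (S.plugL L (S.ƛ t) S.· u) ≡ plugL (cbvL L) (ƛ (cbv t)) · cbv u
  lhs = trans (cong (λ a → cbvApp a (cbv u)) (cbv-plugL L (S.ƛ t)))
    (cbvApp-unbang (cbv u) (plugL-unbang (cbvL L) bang))

  rhs : cbv (S.plugL L (t S.[\ S.rename (S.under L) u ])) ≡
        plugL (cbvL L) (cbv t [\ rename (under (cbvL L)) (cbv u) ])
  rhs = trans (cbv-plugL L _)
    (cong (λ a → plugL (cbvL L) (cbv t [\ a ]))
      (trans (cbv-rename (S.under L) u)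
        (cong (λ ρ → rename ρ (cbv u)) (under-cbvL L))))
cbv-root (S.sv (S.sv t L {v} val)) with cbv-value val
... | w , eq =
  subst₂ _↦⟨ exp ⟩_ (sym lhs) (sym rhs) (s! (cbv t) (cbvL L) w)
  where
  lhs : cbv (t S.[\ S.plugL L v ]) ≡ cbv t [\ plugL (cbvL L) (! w) ]
  lhs = cong (cbv t [\_])
    (trans (cbv-plugL L v) (cong (plugL (cbvL L)) eq))

  rhs : cbv (S.plugL L (S.rename (lift (S.under L)) t S.⟪\ v ⟫)) ≡
        plugL (cbvL L) (rename (lift (under (cbvL L))) (cbv t) ⟪\ w ⟫)
  rhs = trans (cbv-plugL L _) (cong (plugL (cbvL L)) (begin
    cbv (S.rename (lift (S.under L)) t S.⟪\ v ⟫)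
      ≡⟨ cbv-⟪\⟫ (S.rename (lift (S.under L)) t) eq ⟩
    cbv (S.rename (lift (S.under L)) t) ⟪\ w ⟫
      ≡⟨ cong _⟪\ w ⟫ (cbv-rename (lift (S.under L)) t) ⟩
    rename (lift (S.under L)) (cbv t) ⟪\ w ⟫
      ≡⟨ cong (λ ρ → rename (lift ρ) (cbv t) ⟪\ w ⟫) (under-cbvL L) ⟩
    rename (lift (under (cbvL L))) (cbv t) ⟪\ w ⟫ ∎))
    where open ≡-Reasoning

-- Weak contexts do not enter a bang, so the bang takes part in no step.
unbang-plugW : (W : WCtx m n) {t u : Term n} {w : Term m} → t ↦⟨ k ⟩ u →
  Unbang (plugW W t) w → ∃[ w′ ] Unbang (plugW W u) w′ × w →w⟨ k ⟩ w′
-- Among root redexes only those of `s!` are explicit substitutions. The bang sits in the body `t`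
-- and survives the substitution, and the same rule fires on the unbanged body.
unbang-plugW □ (s! t L u) (sub b) =
  _ , plugL-unbang L (unbang-subst _ (unbang-rename _ b)) , step □ (s! _ L u)
unbang-plugW (W [\ u ]ˡ) r (sub b) with unbang-plugW W r b
... | _ , b′ , r′ = _ , sub b′ , step-[\]ˡ r′
unbang-plugW (t [\ W ]ʳ) r (sub b) = _ , sub b , step (_ [\ W ]ʳ) r

unbang-step : {t u w : Term n} → Unbang t w → t →w⟨ k ⟩ u →
  ∃[ w′ ] Unbang u w′ × w →w⟨ k ⟩ w′
unbang-step b (step W r) = unbang-plugW W r b

unbang-steps : {t u w : Term n} → Unbang t w → Star _→w⟨ exp ⟩_ t u →
  ∃[ w′ ] Unbang u w′ × Star _→w⟨ exp ⟩_ w w′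
unbang-steps b ε = _ , b , ε
unbang-steps b (r ◅ rs) with unbang-step b r
... | _ , b′ , r′ with unbang-steps b′ rs
...   | w , b″ , rs′ = w , b″ , r′ ◅ rs′

-- One step of the given kind, then the d!-steps that remove the der created by
-- a function part which was not yet of the form L⟨!s⟩.
Sim : Kind → Term n → Term n → Set
Sim k t u = ∃[ p ] (t →w⟨ k ⟩ p) × Star _→w⟨ exp ⟩_ p u

sim-cong : (f : Term n → Term m) →
  (∀ {k t u} → t →w⟨ k ⟩ u → f t →w⟨ k ⟩ f u) →
  {t u : Term n} → Sim k t u → Sim k (f t) (f u)
sim-cong f f-step (p , r , rs) = f p , f-step r , gmap f f-step rs

-- The branch depends on the function part alone, so it is the same for both arguments.
sim-cbvAppʳ : (t : Term n) {u u′ : Term n} →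
  Sim k u u′ → Sim k (cbvApp t u) (cbvApp t u′)
sim-cbvAppʳ t with banged? t
... | yes (_ , L , s , _) =
      sim-cong (plugL L s ·_) step-·ʳ
... | no _ = sim-cong (der t ·_) step-·ʳ

d!-unbang : {t w : Term n} → Unbang t w → der t ↦⟨ exp ⟩ w
d!-unbang b with unbang-decompose b
... | _ , L , s , refl , refl = d! L s

sim-cbvAppˡ : {t t′ : Term n} (u : Term n) → Shape t → Shape t′ →
  Sim k t t′ → Sim k (cbvApp t u) (cbvApp t′ u)
-- Steps never destroy the bang, so the whole simulation is replayed on the unbanged function part.
sim-cbvAppˡ u (inj₁ (_ , b)) _ (_ , r , rs) with unbang-step b r
... | _ , b₁ , r′ with unbang-steps b₁ rs
...   | _ , b₂ , rs′ =
  subst₂ (Sim _) (sym (cbvApp-unbang u b)) (sym (cbvApp-unbang u b₂))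
    (sim-cong (_· u) step-·ˡ (_ , r′ , rs′))
sim-cbvAppˡ u (inj₂ a) sh σ
  with sim-cong (λ x → der x · u) (step-·ˡ ∘ step-der) σ | sh
... | σ′ | inj₂ a′ =
  subst₂ (Sim _) (sym (cbvApp-der u a)) (sym (cbvApp-der u a′)) σ′
-- The reduct has acquired a bang: its translated application has no `der`, and a final `d!`-step
-- removes the one still present.
... | p , r , rs | inj₁ (_ , b) =
  subst₂ (Sim _) (sym (cbvApp-der u a)) (sym (cbvApp-unbang u b))
    (p , r , rs ◅◅ step (□ ·ˡ u) (d!-unbang b) ◅ ε)

cbv-sim : (V : S.VCtx m n) {t u : S.Term n} → t S.↦v⟨ k ⟩ u →
  Sim k (cbv (S.plugV V t)) (cbv (S.plugV V u))
cbv-sim S.□ r = _ , step □ (cbv-root r) , ε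
cbv-sim (V S.·ˡ u) r =
  sim-cbvAppˡ (cbv u) (cbv-shape (S.plugV V _)) (cbv-shape (S.plugV V _))
    (cbv-sim V r)
cbv-sim (u S.·ʳ V) r = sim-cbvAppʳ (cbv u) (cbv-sim V r)
cbv-sim (V S.[\ u ]ˡ) r =
  sim-cong (_[\ cbv u ]) step-[\]ˡ (cbv-sim V r)
cbv-sim (u S.[\ V ]ʳ) r =
  sim-cong (cbv u [\_]) step-[\]ʳ (cbv-sim V r)

-- From the simulations to the reduction relations of the statement.

◅⇒⁺ : {A : Set} {R : A → A → Set} {x y z : A} →
  R x y → Star R y z → TransClosure R x z
◅⇒⁺ r ε        = [ r ]
◅⇒⁺ r (q ◅ qs) = r ∷ ◅⇒⁺ q qs

cbn-step : {t s : S.Term n} → t →n⟨ k ⟩ s → cbn t →w⟨ k ⟩ cbn s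
cbn-step (S.step N r) = cbn-sim N r

cbv-step : {t s : S.Term n} → t →v⟨ k ⟩ s → Sim k (cbv t) (cbv s)
cbv-step (S.step V r) = cbv-sim V r

forget-kind : {t u : Term n} → Star _→w⟨ exp ⟩_ t u → t →w* u
forget-kind = Star.map (exp ,_)

lemma4p6 : (n : ℕ) (t s : Source.Term n) →
    ((t →n s → cbn t →w cbn s)
    × (t →n⟨ exp ⟩ s → cbn t →w⟨ exp ⟩ cbn s)
    × (t →n⟨ mul ⟩ s → cbn t →w⟨ mul ⟩ cbn s))
    × ((t →v s → cbv t →w⁺ cbv s)
    × (t →v⟨ exp ⟩ s → cbv t →w⟨exp⟩⁺ cbv s)
    × (t →v⟨ mul ⟩ s → cbv t →w*∋mul cbv s))
lemma4p6 n t s = (map₂ cbn-step , cbn-step , cbn-step) , (any , exps , muls)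
  where
  any : t →v s → cbv t →w⁺ cbv s
  any (k , r) with cbv-step r
  ... | _ , q , qs = ◅⇒⁺ (k , q) (forget-kind qs)

  exps : t →v⟨ exp ⟩ s → cbv t →w⟨exp⟩⁺ cbv s
  exps r with cbv-step r
  ... | _ , q , qs = ◅⇒⁺ q qs

  muls : t →v⟨ mul ⟩ s → cbv t →w*∋mul cbv s
  muls r with cbv-step r
  -- The multiplicative step comes first, so the reduction before it is empty.
  ... | p , q , qs = cbv t , p , ε , q , forget-kind qs
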